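{- Let $\Pi_{\mathcal A}=\{1324,1342,2413,2431,3124,3142,4213,4231\}$ and $\Pi_{\mathcal S}=\{1243,1423,2143,4123,2413,4213,2431,4231\}$. Then for all $n\ge 0$, $$Q_n(\Pi_{\mathcal S})=Q_n(\Pi_{\mathcal A}).$$
   Context: $\mathfrak{S}_n$ is the set of permutations of $[n]$ in one-line notation. A permutation $\sigma$ contains $\pi$ as a pattern if some (not necessarily consecutive) subsequence of $\sigma$ is order-isomorphic to $\pi$; otherwise it avoids $\pi$. $\mathfrak{S}_n(\Pi)$ is the set of $\sigma\in\mathfrak{S}_n$ avoiding every $\pi\in\Pi$. $\mathrm{Des}\,\sigma=\{i\mid\sigma_i>\sigma_{i+1}\}\subseteq[n-1]$. For $S\subseteq[n-1]$, $F_S=\sum x_{i_1}\cdots x_{i_n}$ over all $i_1\le\dots\le i_n$ with $i_s<i_{s+1}$ whenever $s\in S$. $Q_n(\Pi)=\sum_{\sigma\in\mathfrak{S}_n(\Pi)}F_{\mathrm{Des}\,\sigma}$. (The elements of $\mathfrak{S}_n(\Pi_{\mathcal A})$ are the arc permutations: those for which every prefix is an interval in the integers modulo $n$. The set $\Pi_{\mathcal S}$ is the set of permutations in $\mathfrak S_4$ in which $1$ is inserted in an arbitrary position of $243$ or of $423$, i.e. the shuffle of $\{1\}$ with $\{132,312\}$.) -}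

module Defs where

open import Data.Fin.Base using (Fin; zero; suc; inject₁; _<_; _≤_)
open import Data.Fin.Properties using (_≟_; _<?_; _≤?_; all?; any?)
open import Data.Fin.Subset using (Subset; _∈_)
open import Data.Fin.Subset.Properties using (_∈?_)
open import Data.List.Base as List using (List; []; _∷_; cartesianProductWith; allFin; filter; length)
open import Data.List.Relation.Unary.All as ListAll using ()
import Data.List.Membership.Propositional as List∈
open import Data.List.Membership.Propositional.Properties using (∈-cartesianProductWith⁺; ∈-allFin)
open import Data.List.Relation.Unary.Any using (here)
import Data.List.Relation.Unary.AllPairs as ListAllPairs
open import Data.List.Relation.Unary.Unique.Propositional using () renaming (Unique to UniqueList)
open import Data.List.Relation.Unary.Unique.Propositional.Properties using (cartesianProductWith⁺; allFin⁺)
open import Data.Nat.Base using (ℕ; zero; suc; _∸_)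
import Data.Nat.Properties as ℕ
open import Data.Nat.ListAction using (sum)
open import Data.Product.Base using (∃; _×_; _,_)
open import Data.Vec.Base using (Vec; []; _∷_; lookup; tabulate; count)
open import Data.Vec.Properties using (≡-dec; ∷-injective)
open import Data.Vec.Relation.Unary.AllPairs using (allPairs?)
open import Data.Vec.Relation.Unary.Unique.Propositional using (Unique)
open import Relation.Binary.PropositionalEquality using (_≡_; refl)
open import Relation.Nullary using (Dec; does; ¬_; ¬?; _×-dec_; _→-dec_)
open import Relation.Nullary.Decidable using (map′)
open import Relation.Unary using (Decidable)

-- Words of length n over k letters.
Word : ℕ → ℕ → Set
Word k n = Vec (Fin k) n

words : ∀ k n → List (Word k n)
words k zero    = [] ∷ []
words k (suc n) = cartesianProductWith _∷_ (allFin k) (words k n)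

-- words k n lists every word exactly once, so filtering it and taking the
-- length counts the words with a given property.
∈-words : ∀ {k n} (w : Word k n) → w List∈.∈ words k n
∈-words []      = here refl
∈-words (x ∷ w) = ∈-cartesianProductWith⁺ _∷_ (∈-allFin x) (∈-words w)

words-unique : ∀ k n → UniqueList (words k n)
words-unique k zero    = ListAll.[] ListAllPairs.∷ ListAllPairs.[]
words-unique k (suc n) =
  cartesianProductWith⁺ _∷_ ∷-injective (allFin⁺ k) (words-unique k n)

-- A word over [n] of length n; it is the one-line notation of a permutation
-- when its letters are distinct.  Letters and positions are numbered from 0.
OneLine : ℕ → Set
OneLine n = Word n n

IsPerm : ∀ {n} → OneLine n → Set
IsPerm = Unique

isPerm? : ∀ {n} → Decidable (IsPerm {n})
isPerm? = allPairs? (λ x y → ¬? (x ≟ y))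

-- p lists the positions of the chosen subsequence of σ.
Occurrence : ∀ {k n} → OneLine k → OneLine n → Vec (Fin n) k → Set
Occurrence π σ p =
    (∀ a b → a < b → lookup p a < lookup p b)
  × (∀ a b → (lookup π a < lookup π b → lookup σ (lookup p a) < lookup σ (lookup p b))
           × (lookup σ (lookup p a) < lookup σ (lookup p b) → lookup π a < lookup π b))

Contains : ∀ {k n} → OneLine k → OneLine n → Set
Contains π σ = ∃ (Occurrence π σ)

Avoids : ∀ {k n} → List (OneLine k) → OneLine n → Set
Avoids Π σ = ListAll.All (λ π → ¬ Contains π σ) Π

occurrence? : ∀ {k n} (π : OneLine k) (σ : OneLine n) → Decidable (Occurrence π σ)
occurrence? π σ p =
  all? (λ a → all? λ b → a <? b →-dec lookup p a <? lookup p b)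
  ×-dec
  all? (λ a → all? λ b →
    (lookup π a <? lookup π b →-dec lookup σ (lookup p a) <? lookup σ (lookup p b))
    ×-dec
    (lookup σ (lookup p a) <? lookup σ (lookup p b) →-dec lookup π a <? lookup π b))

anyWord? : ∀ {k n} {P : Word k n → Set} → Decidable P → Dec (∃ P)
anyWord? {n = zero}  P? = map′ (λ p → [] , p) (λ { ([] , p) → p }) (P? [])
anyWord? {n = suc n} P? =
  map′ (λ { (x , w , p) → (x ∷ w) , p }) (λ { ((x ∷ w) , p) → x , w , p })
       (any? λ x → anyWord? λ w → P? (x ∷ w))

contains? : ∀ {k n} (π : OneLine k) (σ : OneLine n) → Dec (Contains π σ)
contains? π σ = anyWord? (occurrence? π σ)

avoids? : ∀ {k n} (Π : List (OneLine k)) → Decidable (Avoids {k} {n} Π)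
avoids? Π σ = ListAll.all? (λ π → ¬? (contains? π σ)) Π

𝔖 : ∀ n {k} → List (OneLine k) → List (OneLine n)
𝔖 n Π = filter (λ σ → isPerm? σ ×-dec avoids? Π σ) (words n n)

-- The pairs of adjacent positions (left s , right s) in a sequence of length n
-- are indexed by [n-1], represented by Fin (n ∸ 1), which is empty for n = 0.
left right : ∀ {n} → Fin (n ∸ 1) → Fin n
left  {suc n} = inject₁
right {suc n} = suc

Des : ∀ {n} → OneLine n → Subset (n ∸ 1)
Des σ = tabulate λ s → does (lookup σ (right s) <? lookup σ (left s))

-- Formal power series with natural number coefficients in the variables
-- x₀, x₁, x₂, …, as coefficient functions: f (a₀ ∷ … ∷ aₖ₋₁ ∷ []) is the
-- coefficient of x₀^a₀ ⋯ xₖ₋₁^aₖ₋₁.  As k is arbitrary and exponents may be 0,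
-- every monomial in the infinitely many variables is covered.
PowerSeries : Set
PowerSeries = ∀ {k} → Vec ℕ k → ℕ

infix 4 _≈_
_≈_ : PowerSeries → PowerSeries → Set
f ≈ g = ∀ {k} (a : Vec ℕ k) → f a ≡ g a

-- The exponent vector of x_{i₁} ⋯ x_{iₙ}.
exponents : ∀ {k n} → Word k n → Vec ℕ k
exponents i = tabulate λ v → count (v ≟_) i

-- i₁ ≤ … ≤ iₙ, with strict inequality at the positions in S.
Admissible : ∀ {k n} → Subset (n ∸ 1) → Word k n → Set
Admissible {n = n} S i =
    (∀ (s : Fin (n ∸ 1)) → lookup i (left s) ≤ lookup i (right s))
  × (∀ (s : Fin (n ∸ 1)) → s ∈ S → lookup i (left s) < lookup i (right s))

admissible? : ∀ {k n} (S : Subset (n ∸ 1)) → Decidable (Admissible {k} {n} S)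
admissible? S i =
  all? (λ s → lookup i (left s) ≤? lookup i (right s))
  ×-dec
  all? (λ s → s ∈? S →-dec lookup i (left s) <? lookup i (right s))

-- The coefficient of x^a in F_S is the number of admissible index sequences
-- whose monomial is x^a.  Such a sequence only uses indices below the length k
-- of a, so it is enough to count among words over Fin k.
F : ∀ n → Subset (n ∸ 1) → PowerSeries
F n S {k} a =
  length (filter (λ i → admissible? S i ×-dec ≡-dec ℕ._≟_ (exponents i) a) (words k n))

Q : ∀ n {k} → List (OneLine k) → PowerSeries
Q n Π a = sum (List.map (λ σ → F n (Des σ) a) (𝔖 n Π))

pattern 𝟏 = zero
pattern 𝟐 = suc zero
pattern 𝟑 = suc (suc zero)
pattern 𝟒 = suc (suc (suc zero))

Π𝒜 Π𝒮 : List (OneLine 4)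
Π𝒜 = (𝟏 ∷ 𝟑 ∷ 𝟐 ∷ 𝟒 ∷ []) ∷ (𝟏 ∷ 𝟑 ∷ 𝟒 ∷ 𝟐 ∷ [])
  ∷ (𝟐 ∷ 𝟒 ∷ 𝟏 ∷ 𝟑 ∷ []) ∷ (𝟐 ∷ 𝟒 ∷ 𝟑 ∷ 𝟏 ∷ [])
  ∷ (𝟑 ∷ 𝟏 ∷ 𝟐 ∷ 𝟒 ∷ []) ∷ (𝟑 ∷ 𝟏 ∷ 𝟒 ∷ 𝟐 ∷ [])
  ∷ (𝟒 ∷ 𝟐 ∷ 𝟏 ∷ 𝟑 ∷ []) ∷ (𝟒 ∷ 𝟐 ∷ 𝟑 ∷ 𝟏 ∷ [])
  ∷ []
Π𝒮 = (𝟏 ∷ 𝟐 ∷ 𝟒 ∷ 𝟑 ∷ []) ∷ (𝟏 ∷ 𝟒 ∷ 𝟐 ∷ 𝟑 ∷ [])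
  ∷ (𝟐 ∷ 𝟏 ∷ 𝟒 ∷ 𝟑 ∷ []) ∷ (𝟒 ∷ 𝟏 ∷ 𝟐 ∷ 𝟑 ∷ [])
  ∷ (𝟐 ∷ 𝟒 ∷ 𝟏 ∷ 𝟑 ∷ []) ∷ (𝟒 ∷ 𝟐 ∷ 𝟏 ∷ 𝟑 ∷ [])
  ∷ (𝟐 ∷ 𝟒 ∷ 𝟑 ∷ 𝟏 ∷ []) ∷ (𝟒 ∷ 𝟐 ∷ 𝟑 ∷ 𝟏 ∷ [])
  ∷ []

module Submission where

-- A permutation σ is determined by its inversions T i j = [σ_j < σ_i], i < j.
-- σ avoids Π𝒮 iff T i k = T j k whenever i < j < k differ from the position
-- of the least letter, and it avoids Π𝒜 iff T i j is w at the gap of [i, j-1] nearest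
-- to some gap g, where w s = T s (s+1) is the descent word.  For n ≥ 2, both
-- kinds of avoiders with descent word w correspond to the runs of equal letters
-- of w: moving g within a run does not change an arc permutation, and in an
-- avoider of Π𝒮 the least letter sits at the start of a run of ascents or at the
-- end of a run of descents, the comparison across it telling which of the two.

open import Defs
open import Data.Bool.Base using (Bool; true; false; _xor_; if_then_else_)
import Data.Bool.Properties as Bool
open import Data.Fin.Base as Fin using (Fin; zero; suc; toℕ; fromℕ<; punchOut)
import Data.Fin.Properties as Finₚ
open import Data.Fin.Properties using
  (toℕ<n; toℕ-fromℕ<; toℕ-injective; toℕ-inject₁; any?; injective⇒≤; punchOut-injective)
open import Data.Fin.Subset using (Subset; _∈_; ∣_∣)
open import Data.Fin.Subset.Properties using (anySubset?; p⊂q⇒∣p∣<∣q∣; ∣⊤∣≡n; ∈⊤)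
open import Data.List.Base as List using (List; []; _∷_; allFin; cartesianProductWith; cartesianProduct; filter)
import Data.List.Membership.DecPropositional as DecMembership
import Data.List.Membership.Propositional as List∈
open import Data.List.Membership.Propositional.Properties using
  (∈-map⁺; ∈-map⁻; ∈-filter⁺; ∈-filter⁻; ∈-allFin; ∈-cartesianProduct⁺; ∈-cartesianProductWith⁺)
open import Data.List.Membership.Propositional.Properties.WithK using (unique∧set⇒bag)
open import Data.List.Properties using (map-∘; map-cong-local)
open import Data.List.Relation.Binary.BagAndSetEquality using (∼bag⇒↭)
open import Data.List.Relation.Binary.Permutation.Propositional using (_↭_)
import Data.List.Relation.Binary.Permutation.Propositional.Properties as ↭
open import Data.List.Relation.Unary.All as All using (All; []; _∷_)
import Data.List.Relation.Unary.All.Properties as All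
open import Data.List.Relation.Unary.AllPairs using ([]; _∷_)
open import Data.List.Relation.Unary.Any using (here; there)
open import Data.List.Relation.Unary.Unique.Propositional using () renaming (Unique to UniqueList)
import Data.List.Relation.Unary.Unique.Propositional.Properties as UniqueList
open import Data.Nat.Base using (ℕ; zero; suc; pred; _+_; _<_; _≤_; _⊔_; _⊓_; _∸_; z≤n; s≤s; z<s; s<s; s<s⁻¹; s≤s⁻¹)
open import Data.Nat.ListAction using (sum)
open import Data.Nat.ListAction.Properties using (sum-↭)
open import Data.Nat.Properties
open import Data.Product.Base using (∃; _×_; _,_; proj₁; proj₂; uncurry)
open import Data.Sum.Base using (_⊎_; inj₁; inj₂)
open import Data.Vec.Base using (Vec; []; _∷_; lookup; tabulate; map)
open import Data.Vec.Properties using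
  (≡-dec; lookup-map; lookup∘tabulate; tabulate∘lookup; tabulate-cong; lookup⇒[]=; []=⇒lookup; ∷-injective)
open import Data.Vec.Relation.Unary.Unique.Propositional.Properties using (lookup-injective; tabulate⁺)
open import Function.Base using (_∘_; case_of_)
open import Function.Bundles using (mk⇔)
open import Relation.Binary.Definitions using (Tri; tri<; tri≈; tri>)
open import Relation.Binary.PropositionalEquality
open import Relation.Nullary using (Dec; yes; no; does; ¬_; ¬?; _×-dec_; _⊎-dec_; _→-dec_; contradiction)
open import Relation.Nullary.Decidable using (map′; dec-true; dec-false; does-⇔; decidable-stable; from-yes)
open import Relation.Unary using (Decidable)

-- `F` sees only the descent set, so it suffices that for each descent word the two classes have
-- equally many members. No map between the classes is written down: each is listed by the same
-- pairs of a descent word and a canonical gap, where n letters have `N` = n - 1 gaps. The work is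
-- done on tables because the transitivity condition `Mediated` already guarantees that a table
-- comes from a permutation, so the permutation with a given code never has to be described letter
-- by letter. Since all patterns have length 4, avoidance becomes a condition on the six comparisons
-- among four positions, which is settled by exhaustion. A single letter leaves no gap and hence no
-- run, although there is one permutation; this is why n = 0 and n = 1 stand apart.

private
  variable
    n : ℕ

-- Words and permutations read at natural-number positions

nth : ∀ {A : Set} → A → Vec A n → ℕ → A
nth d []       _       = d
nth d (x ∷ xs) zero    = x
nth d (x ∷ xs) (suc i) = nth d xs i

nth-lookup : ∀ {A : Set} (d : A) (xs : Vec A n) i → nth d xs (toℕ i) ≡ lookup xs i
nth-lookup d (x ∷ xs) zero    = refl
nth-lookup d (x ∷ xs) (suc i) = nth-lookup d xs i

nth-beyond : ∀ {A : Set} (d : A) (xs : Vec A n) {i} → n ≤ i → nth d xs i ≡ d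
nth-beyond d []       _       = refl
nth-beyond d (x ∷ xs) (s≤s p) = nth-beyond d xs p

nth-< : ∀ {A : Set} (d : A) (xs : Vec A n) {i} (i<n : i < n) → nth d xs i ≡ lookup xs (fromℕ< i<n)
nth-< d xs i<n = trans (cong (nth d xs) (sym (toℕ-fromℕ< i<n))) (nth-lookup d xs _)

lookup-ext : ∀ {A : Set} (xs ys : Vec A n) → (∀ i → lookup xs i ≡ lookup ys i) → xs ≡ ys
lookup-ext xs ys h = trans (sym (tabulate∘lookup xs)) (trans (tabulate-cong h) (tabulate∘lookup ys))

nth-ext : ∀ {A : Set} (d : A) (xs ys : Vec A n) → (∀ i → i < n → nth d xs i ≡ nth d ys i) → xs ≡ ys
nth-ext d xs ys h = lookup-ext xs ys λ i →
  trans (sym (nth-lookup d xs i)) (trans (h (toℕ i) (toℕ<n i)) (nth-lookup d ys i))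

false≢true : false ≢ true
false≢true ()

does⁻ : ∀ {A : Set} (a? : Dec A) → does a? ≡ true → A
does⁻ (yes a) _ = a

val : OneLine n → ℕ → ℕ
val σ = nth 0 (map toℕ σ)

val-lookup : (σ : OneLine n) (i : Fin n) → val σ (toℕ i) ≡ toℕ (lookup σ i)
val-lookup σ i = trans (nth-lookup 0 (map toℕ σ) i) (lookup-map i toℕ σ)

val-< : (σ : OneLine n) {i : ℕ} (i<n : i < n) → val σ i ≡ toℕ (lookup σ (fromℕ< i<n))
val-< σ i<n = trans (nth-< 0 (map toℕ σ) i<n) (lookup-map (fromℕ< i<n) toℕ σ)

val<n : (σ : OneLine n) {i : ℕ} → i < n → val σ i < n
val<n σ i<n = subst (_< _) (sym (val-< σ i<n)) (toℕ<n _)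

val-injective : {σ : OneLine n} → IsPerm σ → ∀ {i j} → i < n → j < n → val σ i ≡ val σ j → i ≡ j
val-injective {σ = σ} u {i} {j} i<n j<n eq = begin
  i                  ≡⟨ toℕ-fromℕ< i<n ⟨
  toℕ (fromℕ< i<n)   ≡⟨ cong toℕ (lookup-injective u _ _ (toℕ-injective
                          (trans (sym (val-< σ i<n)) (trans eq (val-< σ j<n))))) ⟩
  toℕ (fromℕ< j<n)   ≡⟨ toℕ-fromℕ< j<n ⟩
  j                  ∎
  where open ≡-Reasoning

-- Pigeonhole: deleting a missed value from the codomain would leave an injection into a set with
-- one element fewer.
injective⇒surjective : (f : Fin n → Fin n) → (∀ {i j} → f i ≡ f j → i ≡ j) → ∀ v → ∃ λ i → f i ≡ v
injective⇒surjective {suc n} f inj v with any? (λ i → f i Finₚ.≟ v)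
... | yes p = p
... | no ¬p = contradiction
  (injective⇒≤ {f = λ i → punchOut (v≢ i)} λ {i} {j} eq → inj (punchOut-injective (v≢ i) (v≢ j) eq))
  1+n≰n
  where v≢ : ∀ i → v ≢ f i
        v≢ i eq = ¬p (i , sym eq)

val-surjective : {σ : OneLine n} → IsPerm σ → ∀ {v} → v < n → ∃ λ i → i < n × val σ i ≡ v
val-surjective {σ = σ} u v<n with injective⇒surjective (lookup σ) (lookup-injective u _ _) (fromℕ< v<n)
... | i , eq = toℕ i , toℕ<n i , trans (val-lookup σ i) (trans (cong toℕ eq) (toℕ-fromℕ< v<n))

Table : Set
Table = ℕ → ℕ → Bool

inv : OneLine n → Table
inv σ i j = does (val σ j <? val σ i)

Between : Bool → Bool → Bool → Set
Between x y z = y ≡ x ⊎ y ≡ z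

-- Equivalently, inversions are transitive and so are non-inversions: when the two outer bits agree
-- the middle one must equal them, and otherwise nothing is asked. This is the classical description
-- of inversion sets.
Mediated : Table → Set
Mediated T = ∀ {i j k} → i < j → j < k → Between (T i j) (T i k) (T j k)

inv-true : (σ : OneLine n) {i j : ℕ} → val σ j < val σ i → inv σ i j ≡ true
inv-true σ = dec-true (_ <? _)

inv-false : (σ : OneLine n) {i j : ℕ} → val σ i ≤ val σ j → inv σ i j ≡ false
inv-false σ p = dec-false (_ <? _) (≤⇒≯ p)

inv-true⁻ : (σ : OneLine n) {i j : ℕ} → inv σ i j ≡ true → val σ j < val σ i
inv-true⁻ σ = does⁻ (_ <? _)

inv-false⁻ : (σ : OneLine n) {i j : ℕ} → inv σ i j ≡ false → val σ i ≤ val σ j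
inv-false⁻ σ eq = ≮⇒≥ λ p → false≢true (trans (sym eq) (inv-true σ p))

inv-mediated : (σ : OneLine n) → Mediated (inv σ)
inv-mediated σ {i} {j} {k} _ _ with inv σ i j in a | inv σ j k in b
... | true  | true  = inj₁ (inv-true σ (<-trans (inv-true⁻ σ b) (inv-true⁻ σ a)))
... | false | false = inj₁ (inv-false σ (≤-trans (inv-false⁻ σ a) (inv-false⁻ σ b)))
... | true  | false with inv σ i k
...   | true  = inj₁ refl
...   | false = inj₂ refl
inv-mediated σ {i} {j} {k} _ _ | false | true with inv σ i k
...   | true  = inj₂ refl
...   | false = inj₁ refl

inv-lookup : (σ : OneLine n) (a b : Fin n) →
             inv σ (toℕ a) (toℕ b) ≡ does (lookup σ b Finₚ.<? lookup σ a)
inv-lookup σ a b = cong₂ (λ x y → does (x <? y)) (val-lookup σ b) (val-lookup σ a)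

-- Permutations and their inversion tables

Agree : ℕ → Table → Table → Set
Agree n T T′ = ∀ {i j} → i < j → j < n → T i j ≡ T′ i j

inv-agree-< : {σ τ : OneLine n} → IsPerm τ → Agree n (inv σ) (inv τ) →
              ∀ {i j} → i < n → j < n → val σ j < val σ i → val τ j < val τ i
inv-agree-< {σ = σ} {τ} uτ eq {i} {j} i<n j<n lt with <-cmp i j
... | tri< i<j _ _    = inv-true⁻ τ (trans (sym (eq i<j j<n)) (inv-true σ lt))
... | tri≈ _ refl _   = contradiction lt (<-irrefl refl)
... | tri> _ i≢j j<i  = ≤∧≢⇒< (inv-false⁻ τ (trans (sym (eq j<i i<n)) (inv-false σ (<⇒≤ lt))))
                              λ e → i≢j (sym (val-injective uτ j<n i<n e))

-- Induction on the letter: the position of `v` in `σ` carries at least `v` in `τ`, and the position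
-- of `suc v` must carry strictly more. Exchanging `σ` and `τ` gives equality.
inv-agree-≤ : {σ τ : OneLine n} → IsPerm σ → IsPerm τ → Agree n (inv σ) (inv τ) →
              ∀ v {i} → i < n → val σ i ≡ v → v ≤ val τ i
inv-agree-≤ uσ uτ eq zero i<n _ = z≤n
inv-agree-≤ {n} {σ} {τ} uσ uτ eq (suc v) {i} i<n ev
  with j , j<n , ej ← val-surjective uσ {v} (<-trans (n<1+n v) (subst (_< n) ev (val<n σ i<n)))
  = ≤-<-trans (inv-agree-≤ {σ = σ} {τ} uσ uτ eq v j<n ej)
      (inv-agree-< {σ = σ} {τ} uτ eq i<n j<n (subst₂ _<_ (sym ej) (sym ev) (n<1+n v)))

inv-injective : {σ τ : OneLine n} → IsPerm σ → IsPerm τ → Agree n (inv σ) (inv τ) → σ ≡ τ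
inv-injective {σ = σ} {τ} uσ uτ eq = lookup-ext σ τ λ i → toℕ-injective (begin
  toℕ (lookup σ i) ≡⟨ val-lookup σ i ⟨
  val σ (toℕ i)    ≡⟨ ≤-antisym (inv-agree-≤ {σ = σ} {τ} uσ uτ eq _ (toℕ<n i) refl)
                                (inv-agree-≤ {σ = τ} {σ} uτ uσ (λ p q → sym (eq p q)) _ (toℕ<n i) refl) ⟩
  val τ (toℕ i)    ≡⟨ val-lookup τ i ⟩
  toℕ (lookup τ i) ∎)
  where open ≡-Reasoning

-- Every mediated table is the inversion table of a permutation

module Realisation (T : Table) (mediated : Mediated T) where

  Less : ℕ → ℕ → Set
  Less i j = (i < j × T i j ≡ false) ⊎ (j < i × T j i ≡ true)

  less? : ∀ i j → Dec (Less i j)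
  less? i j = (i <? j ×-dec T i j Bool.≟ false) ⊎-dec (j <? i ×-dec T j i Bool.≟ true)

  less-irrefl : ∀ {i} → ¬ Less i i
  less-irrefl (inj₁ (p , _)) = <-irrefl refl p
  less-irrefl (inj₂ (p , _)) = <-irrefl refl p

  private
    collapse : ∀ {x y z c} → Between x y z → x ≡ c → z ≡ c → y ≡ c
    collapse (inj₁ e) p q = trans e p
    collapse (inj₂ e) p q = trans e q

    first : ∀ {x y z c} → Between x y z → y ≡ c → z ≢ c → x ≡ c
    first (inj₁ e) p q = trans (sym e) p
    first (inj₂ e) p q = contradiction (trans (sym e) p) q

    last : ∀ {x y z c} → Between x y z → y ≡ c → x ≢ c → z ≡ c
    last (inj₁ e) p q = contradiction (trans (sym e) p) q
    last (inj₂ e) p q = trans (sym e) p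

    t≢f : ∀ {b} → b ≡ true → b ≢ false
    t≢f refl ()

    f≢t : ∀ {b} → b ≡ false → b ≢ true
    f≢t refl ()

  -- Mediation speaks of triples sorted by position. If i, j, k are monotone, two equal bits force
  -- the third. Otherwise the bit of the outermost pair is known and differs from one inner bit,
  -- hence equals the other.
  less-trans : ∀ {i j k} → Less i j → Less j k → Less i k
  less-trans (inj₁ (i<j , a)) (inj₁ (j<k , b)) = inj₁ (<-trans i<j j<k , collapse (mediated i<j j<k) a b)
  less-trans (inj₂ (j<i , a)) (inj₂ (k<j , b)) = inj₂ (<-trans k<j j<i , collapse (mediated k<j j<i) b a)
  less-trans {i} {j} {k} (inj₁ (i<j , a)) (inj₂ (k<j , b)) with <-cmp i k
  ... | tri< i<k _ _  = inj₁ (i<k , first (mediated i<k k<j) a (t≢f b))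
  ... | tri≈ _ refl _ = contradiction a (t≢f b)
  ... | tri> _ _ k<i  = inj₂ (k<i , first (mediated k<i i<j) b (f≢t a))
  less-trans {i} {j} {k} (inj₂ (j<i , a)) (inj₁ (j<k , b)) with <-cmp i k
  ... | tri< i<k _ _  = inj₁ (i<k , last (mediated j<i i<k) b (t≢f a))
  ... | tri≈ _ refl _ = contradiction b (t≢f a)
  ... | tri> _ _ k<i  = inj₂ (k<i , last (mediated j<k k<i) a (f≢t b))

  less-total : ∀ {i j} → i ≢ j → Less i j ⊎ Less j i
  less-total {i} {j} i≢j with <-cmp i j
  ... | tri≈ _ e _ = contradiction e i≢j
  ... | tri< i<j _ _ with T i j
  ...   | false = inj₁ (inj₁ (i<j , refl))
  ...   | true  = inj₂ (inj₂ (i<j , refl))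
  less-total {i} {j} i≢j | tri> _ _ j<i with T j i
  ...   | false = inj₂ (inj₁ (j<i , refl))
  ...   | true  = inj₁ (inj₂ (j<i , refl))

  module _ (n : ℕ) where

    smaller : Fin n → Subset n
    smaller i = tabulate λ j → does (less? (toℕ j) (toℕ i))

    smaller⁺ : ∀ {i j} → Less (toℕ j) (toℕ i) → j ∈ smaller i
    smaller⁺ {i} {j} p = lookup⇒[]= j _ (trans (lookup∘tabulate _ j) (dec-true (less? _ _) p))

    smaller⁻ : ∀ {i j} → j ∈ smaller i → Less (toℕ j) (toℕ i)
    smaller⁻ {i} {j} p = does⁻ (less? _ _) (trans (sym (lookup∘tabulate _ j)) ([]=⇒lookup p))

    rank< : ∀ i → ∣ smaller i ∣ < n
    rank< i = subst (∣ smaller i ∣ <_) (∣⊤∣≡n n)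
      (p⊂q⇒∣p∣<∣q∣ ((λ _ → ∈⊤) , i , ∈⊤ , less-irrefl ∘ smaller⁻))

    rank-mono : ∀ {i j} → Less (toℕ i) (toℕ j) → ∣ smaller i ∣ < ∣ smaller j ∣
    rank-mono {i} {j} p = p⊂q⇒∣p∣<∣q∣
      ((λ q → smaller⁺ (less-trans (smaller⁻ q) p)) , i , smaller⁺ p , less-irrefl ∘ smaller⁻)

    -- The letter at a position is its rank in the order `Less`, the number of positions below it.
    -- Ranks increase strictly because the sets `smaller` are strictly nested.
    realise : OneLine n
    realise = tabulate λ i → fromℕ< (rank< i)

    val-realise : ∀ i → val realise (toℕ i) ≡ ∣ smaller i ∣
    val-realise i = trans (val-lookup realise i)
      (trans (cong toℕ (lookup∘tabulate _ i)) (toℕ-fromℕ< (rank< i)))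

    realise-perm : IsPerm realise
    realise-perm = tabulate⁺ λ {i} {j} e → toℕ-injective (inj i j
      (trans (sym (toℕ-fromℕ< (rank< i))) (trans (cong toℕ e) (toℕ-fromℕ< (rank< j)))))
      where
      inj : ∀ i j → ∣ smaller i ∣ ≡ ∣ smaller j ∣ → toℕ i ≡ toℕ j
      inj i j e with toℕ i ≟ toℕ j
      ... | yes p = p
      ... | no ¬p with less-total ¬p
      ...   | inj₁ l = contradiction (rank-mono l) (<-irrefl e)
      ...   | inj₂ l = contradiction (rank-mono l) (<-irrefl (sym e))

    realise-inv : Agree n (inv realise) T
    realise-inv {i} {j} i<j j<n =
      subst₂ (λ x y → inv realise x y ≡ T x y) (toℕ-fromℕ< i<n) (toℕ-fromℕ< j<n)
        (go (fromℕ< i<n) (fromℕ< j<n) (subst₂ _<_ (sym (toℕ-fromℕ< i<n)) (sym (toℕ-fromℕ< j<n)) i<j))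
      where
      i<n = <-trans i<j j<n
      go : ∀ a b → toℕ a < toℕ b → inv realise (toℕ a) (toℕ b) ≡ T (toℕ a) (toℕ b)
      go a b a<b with T (toℕ a) (toℕ b) in e
      ... | true  = inv-true realise (subst₂ _<_ (sym (val-realise b)) (sym (val-realise a))
                      (rank-mono (inj₂ (a<b , e))))
      ... | false = inv-false realise (subst₂ _≤_ (sym (val-realise a)) (sym (val-realise b))
                      (<⇒≤ (rank-mono (inj₁ (a<b , e)))))

open Realisation using (realise; realise-perm; realise-inv)

-- Pattern containment

table : Table → (i j k l : ℕ) → Subset 6
table T i j k l = T i j ∷ T i k ∷ T i l ∷ T j k ∷ T j l ∷ T k l ∷ []

patternTable : OneLine 4 → Subset 6
patternTable π = table (inv π) 0 1 2 3

tables : List (OneLine 4) → List (Subset 6)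
tables = List.map patternTable

table-cong : ∀ {T T′ : Table} {i j k l} → Agree n T T′ → i < j → j < k → k < l → l < n →
             table T i j k l ≡ table T′ i j k l
table-cong eq i<j j<k k<l l<n =
  cong₂ _∷_ (eq i<j j<n) (cong₂ _∷_ (eq (<-trans i<j j<k) k<n) (cong₂ _∷_ (eq (<-trans i<j j<l) l<n)
  (cong₂ _∷_ (eq j<k k<n) (cong₂ _∷_ (eq j<l l<n) (cong (_∷ []) (eq k<l l<n))))))
  where
  j<l = <-trans j<k k<l
  k<n = <-trans k<l l<n
  j<n = <-trans j<k k<n

-- Six bits suffice because neither word has repeated letters: a pair that is not an inversion is
-- then a strict ascent, so both directions of an occurrence can be read off.
table-contains : {π : OneLine 4} {σ : OneLine n} → IsPerm π → IsPerm σ →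
                 ∀ {i j k l} → i < j → j < k → k < l → l < n →
                 patternTable π ≡ table (inv σ) i j k l → Contains π σ
table-contains {n} {π} {σ} uπ uσ {i} {j} {k} {l} i<j j<k k<l l<n eq = p , mono , order
  where
  k<n = <-trans k<l l<n
  j<n = <-trans j<k k<n
  i<n = <-trans i<j j<n
  q : Fin 4 → ℕ
  q = lookup (i ∷ j ∷ k ∷ l ∷ [])
  p : Vec (Fin n) 4
  p = fromℕ< i<n ∷ fromℕ< j<n ∷ fromℕ< k<n ∷ fromℕ< l<n ∷ []
  toℕ-p : ∀ a → toℕ (lookup p a) ≡ q a
  toℕ-p 𝟏 = toℕ-fromℕ< i<n
  toℕ-p 𝟐 = toℕ-fromℕ< j<n
  toℕ-p 𝟑 = toℕ-fromℕ< k<n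
  toℕ-p 𝟒 = toℕ-fromℕ< l<n
  q-mono : ∀ a b → a Fin.< b → q a < q b
  q-mono 𝟏 𝟐 _ = i<j
  q-mono 𝟏 𝟑 _ = <-trans i<j j<k
  q-mono 𝟏 𝟒 _ = <-trans i<j (<-trans j<k k<l)
  q-mono 𝟐 𝟑 _ = j<k
  q-mono 𝟐 𝟒 _ = <-trans j<k k<l
  q-mono 𝟑 𝟒 _ = k<l
  q-mono 𝟐 𝟐 (s≤s ())
  q-mono 𝟑 𝟐 (s≤s ())
  q-mono 𝟑 𝟑 (s≤s (s≤s ()))
  q-mono 𝟒 𝟐 (s≤s ())
  q-mono 𝟒 𝟑 (s≤s (s≤s ()))
  q-mono 𝟒 𝟒 (s≤s (s≤s (s≤s ())))
  mono : ∀ a b → a Fin.< b → lookup p a Fin.< lookup p b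
  mono a b a<b = subst₂ _<_ (sym (toℕ-p a)) (sym (toℕ-p b)) (q-mono a b a<b)
  -- Here `s` numbers the pairs of positions in the lexicographic order used by `table`.
  at : ∀ s {x y} → lookup (patternTable π) s ≡ x → lookup (table (inv σ) i j k l) s ≡ y → x ≡ y
  at s refl refl = cong (λ v → lookup v s) eq
  agree : ∀ a b → a Fin.< b → inv π (toℕ a) (toℕ b) ≡ inv σ (q a) (q b)
  agree 𝟏 𝟐 _ = at zero refl refl
  agree 𝟏 𝟑 _ = at (suc zero) refl refl
  agree 𝟏 𝟒 _ = at (suc (suc zero)) refl refl
  agree 𝟐 𝟑 _ = at (suc (suc (suc zero))) refl refl
  agree 𝟐 𝟒 _ = at (suc (suc (suc (suc zero)))) refl refl
  agree 𝟑 𝟒 _ = at (suc (suc (suc (suc (suc zero))))) refl refl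
  agree 𝟐 𝟐 (s≤s ())
  agree 𝟑 𝟐 (s≤s ())
  agree 𝟑 𝟑 (s≤s (s≤s ()))
  agree 𝟒 𝟐 (s≤s ())
  agree 𝟒 𝟑 (s≤s (s≤s ()))
  agree 𝟒 𝟒 (s≤s (s≤s (s≤s ())))
  agree′ : ∀ a b → a Fin.< b →
           does (lookup π b Finₚ.<? lookup π a) ≡ does (lookup σ (lookup p b) Finₚ.<? lookup σ (lookup p a))
  agree′ a b a<b = begin
    _                                               ≡⟨ inv-lookup π a b ⟨
    inv π (toℕ a) (toℕ b)                           ≡⟨ agree a b a<b ⟩
    inv σ (q a) (q b)                               ≡⟨ cong₂ (inv σ) (toℕ-p a) (toℕ-p b) ⟨
    inv σ (toℕ (lookup p a)) (toℕ (lookup p b))     ≡⟨ inv-lookup σ _ _ ⟩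
    _                                               ∎
    where open ≡-Reasoning
  lookup-π-≢ : ∀ a b → a Fin.< b → toℕ (lookup π a) ≢ toℕ (lookup π b)
  lookup-π-≢ a b a<b e = <-irrefl (cong toℕ (lookup-injective uπ a b (toℕ-injective e))) a<b
  lookup-σ-≢ : ∀ a b → a Fin.< b → toℕ (lookup σ (lookup p a)) ≢ toℕ (lookup σ (lookup p b))
  lookup-σ-≢ a b a<b e = <-irrefl (cong toℕ (lookup-injective uσ _ _ (toℕ-injective e))) (mono a b a<b)
  transfer : ∀ {x y x′ y′} → does (y <? x) ≡ does (y′ <? x′) → x′ ≢ y′ →
             (x < y → x′ < y′) × (y < x → y′ < x′)
  transfer {x} {y} {x′} {y′} e x′≢y′ =
    (λ x<y → ≤∧≢⇒< (≮⇒≥ λ y′<x′ → <-asym x<y (does⁻ (y <? x) (trans e (dec-true (y′ <? x′) y′<x′)))) x′≢y′) ,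
    λ y<x → does⁻ (y′ <? x′) (trans (sym e) (dec-true (y <? x) y<x))
  order : ∀ a b → (lookup π a Fin.< lookup π b → lookup σ (lookup p a) Fin.< lookup σ (lookup p b))
                × (lookup σ (lookup p a) Fin.< lookup σ (lookup p b) → lookup π a Fin.< lookup π b)
  order a b with <-cmp (toℕ a) (toℕ b)
  ... | tri< a<b _ _ = proj₁ (transfer (agree′ a b a<b) (lookup-σ-≢ a b a<b))
                     , proj₁ (transfer (sym (agree′ a b a<b)) (lookup-π-≢ a b a<b))
  ... | tri≈ _ e _ with refl ← toℕ-injective e =
    (λ x → contradiction x (<-irrefl refl)) , λ x → contradiction x (<-irrefl refl)
  ... | tri> _ _ b<a = proj₂ (transfer (agree′ b a b<a) (lookup-σ-≢ b a b<a))
                     , proj₂ (transfer (sym (agree′ b a b<a)) (lookup-π-≢ b a b<a))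

TableAvoids : ℕ → List (OneLine 4) → Table → Set
TableAvoids n Π T = ∀ {i j k l} → i < j → j < k → k < l → l < n → table T i j k l List∈.∉ tables Π

avoids⇒tableAvoids : ∀ {Π} {σ : OneLine n} → All IsPerm Π → IsPerm σ → Avoids Π σ → TableAvoids n Π (inv σ)
avoids⇒tableAvoids {σ = σ} uΠ uσ av i<j j<k k<l l<n t∈
  with π , π∈Π , eq ← ∈-map⁻ patternTable t∈
  = All.lookup av π∈Π (table-contains {π = π} {σ} (All.lookup uΠ π∈Π) uσ i<j j<k k<l l<n (sym eq))

contains⇒table : {π : OneLine 4} {σ : OneLine n} → Contains π σ →
  ∃ λ i → ∃ λ j → ∃ λ k → ∃ λ l → i < j × j < k × k < l × l < n × table (inv σ) i j k l ≡ patternTable π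
contains⇒table {π = π} {σ} (p@(i ∷ j ∷ k ∷ l ∷ []) , mono , order) =
  toℕ i , toℕ j , toℕ k , toℕ l ,
  mono 𝟏 𝟐 (s≤s z≤n) , mono 𝟐 𝟑 (s≤s (s≤s z≤n)) , mono 𝟑 𝟒 (s≤s (s≤s (s≤s z≤n))) , toℕ<n l ,
  cong₂ _∷_ (bit 𝟏 𝟐) (cong₂ _∷_ (bit 𝟏 𝟑) (cong₂ _∷_ (bit 𝟏 𝟒)
  (cong₂ _∷_ (bit 𝟐 𝟑) (cong₂ _∷_ (bit 𝟐 𝟒) (cong (_∷ []) (bit 𝟑 𝟒))))))
  where
  bit : ∀ a b → inv σ (toℕ (lookup p a)) (toℕ (lookup p b)) ≡ inv π (toℕ a) (toℕ b)
  bit a b = begin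
    inv σ (toℕ (lookup p a)) (toℕ (lookup p b))   ≡⟨ inv-lookup σ _ _ ⟩
    _                                             ≡⟨ does-⇔ (mk⇔ (proj₂ (order b a)) (proj₁ (order b a)))
                                                      (_ Finₚ.<? _) (_ Finₚ.<? _) ⟩
    _                                             ≡⟨ inv-lookup π a b ⟨
    inv π (toℕ a) (toℕ b)                         ∎
    where open ≡-Reasoning

tableAvoids⇒avoids : ∀ {Π} {σ : OneLine n} → TableAvoids n Π (inv σ) → Avoids Π σ
tableAvoids⇒avoids {Π = Π} {σ} av = All.tabulate λ {π} π∈Π c →
  case contains⇒table {π = π} {σ} c of λ (_ , _ , _ , _ , i<j , j<k , k<l , l<n , eq) →
    av i<j j<k k<l l<n (subst (List∈._∈ tables Π) (sym eq) (∈-map⁺ patternTable π∈Π))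

-- Pattern conditions as conditions on six bits

allSubsets? : {P : Subset n → Set} → Decidable P → Dec (∀ b → P b)
allSubsets? P? = map′ (λ ¬∃ b → decidable-stable (P? b) λ ¬p → ¬∃ (b , ¬p)) (λ all (b , ¬p) → ¬p (all b))
                      (¬? (anySubset? (¬? ∘ P?)))

-- `Mediated` on four positions. It cuts the 64 bit vectors down to the 24 inversion tables of
-- permutations of four letters.
Consistent : Subset 6 → Set
Consistent (ij ∷ ik ∷ il ∷ jk ∷ jl ∷ kl ∷ []) =
  Between ij ik jk × Between ij il jl × Between ik il kl × Between jk jl kl

consistent? : Decidable Consistent
consistent? (ij ∷ ik ∷ il ∷ jk ∷ jl ∷ kl ∷ []) =
  between? ij ik jk ×-dec between? ij il jl ×-dec between? ik il kl ×-dec between? jk jl kl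
  where
  between? : ∀ x y z → Dec (Between x y z)
  between? x y z = (y Bool.≟ x) ⊎-dec (y Bool.≟ z)

table-consistent : ∀ T → Mediated T → ∀ {i j k l} → i < j → j < k → k < l → Consistent (table T i j k l)
table-consistent T m i<j j<k k<l =
  m i<j j<k , m i<j (<-trans j<k k<l) , m (<-trans i<j j<k) k<l , m j<k k<l

_∈tables?_ : ∀ b Π → Dec (b List∈.∈ tables Π)
b ∈tables? Π = DecMembership._∈?_ (≡-dec Bool._≟_) b (tables Π)

-- The values at the first two positions do not separate those at the last two
-- on the cycle of all values.
Parallel : Subset 6 → Set
Parallel (ij ∷ ik ∷ il ∷ jk ∷ jl ∷ kl ∷ []) = ik xor jk ≡ il xor jl

-- If one of the four values is the least, then the last of the other three
-- values is not between the first two.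
MinimumSplits : Subset 6 → Set
MinimumSplits (ij ∷ ik ∷ il ∷ jk ∷ jl ∷ kl ∷ []) =
    (ij ≡ false → ik ≡ false → il ≡ false → jl ≡ kl)
  × (ij ≡ true  → jk ≡ false → jl ≡ false → il ≡ kl)
  × (ik ≡ true  → jk ≡ true  → kl ≡ false → il ≡ jl)
  × (il ≡ true  → jl ≡ true  → kl ≡ true  → ik ≡ jk)

parallel? : Decidable Parallel
parallel? (ij ∷ ik ∷ il ∷ jk ∷ jl ∷ kl ∷ []) = ik xor jk Bool.≟ il xor jl

minimumSplits? : Decidable MinimumSplits
minimumSplits? (ij ∷ ik ∷ il ∷ jk ∷ jl ∷ kl ∷ []) =
        (ij Bool.≟ false →-dec ik Bool.≟ false →-dec il Bool.≟ false →-dec jl Bool.≟ kl)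
  ×-dec (ij Bool.≟ true  →-dec jk Bool.≟ false →-dec jl Bool.≟ false →-dec il Bool.≟ kl)
  ×-dec (ik Bool.≟ true  →-dec jk Bool.≟ true  →-dec kl Bool.≟ false →-dec il Bool.≟ jl)
  ×-dec (il Bool.≟ true  →-dec jl Bool.≟ true  →-dec kl Bool.≟ true  →-dec ik Bool.≟ jk)

abstract
  -- This and the next three facts are checked on all 64 bit vectors, and are the only places where
  -- the lists of patterns are inspected for their inversions. Being `abstract`, the computations
  -- are not unfolded again.
  ∉Π𝒜⇒parallel : ∀ b → Consistent b → b List∈.∉ tables Π𝒜 → Parallel b
  ∉Π𝒜⇒parallel = from-yes (allSubsets? λ b → consistent? b →-dec ¬? (b ∈tables? Π𝒜) →-dec parallel? b)

  parallel⇒∉Π𝒜 : ∀ b → Parallel b → b List∈.∉ tables Π𝒜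
  parallel⇒∉Π𝒜 = from-yes (allSubsets? λ b → parallel? b →-dec ¬? (b ∈tables? Π𝒜))

  ∉Π𝒮⇒minimumSplits : ∀ b → Consistent b → b List∈.∉ tables Π𝒮 → MinimumSplits b
  ∉Π𝒮⇒minimumSplits = from-yes (allSubsets? λ b → consistent? b →-dec ¬? (b ∈tables? Π𝒮) →-dec minimumSplits? b)

  minimumSplits⇒∉Π𝒮 : ∀ b → MinimumSplits b → b List∈.∉ tables Π𝒮
  minimumSplits⇒∉Π𝒮 = from-yes (allSubsets? λ b → minimumSplits? b →-dec ¬? (b ∈tables? Π𝒮))

  Π𝒜-perm : All IsPerm Π𝒜
  Π𝒜-perm = from-yes (All.all? isPerm? Π𝒜)

  Π𝒮-perm : All IsPerm Π𝒮
  Π𝒮-perm = from-yes (All.all? isPerm? Π𝒮)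

-- Avoiders of `Π𝒮`: a freely placed least letter and constant columns

record Shuffled (n p : ℕ) (T : Table) : Set where
  constructor shuffled
  field
    before : ∀ {i} → i < p → T i p ≡ true
    after  : ∀ {j} → p < j → j < n → T p j ≡ false
    -- Once the least letter is removed, each letter is greater than all earlier ones or smaller
    -- than all of them, which is avoidance of 132 and 312.
    others : ∀ {i j k} → i < j → j < k → k < n → i ≢ p → j ≢ p → k ≢ p → T i k ≡ T j k

  false⇒≢ : ∀ {i j} → i < j → T i j ≡ false → j ≢ p
  false⇒≢ i<j e refl = false≢true (trans (sym e) (before i<j))

  true⇒≢ : ∀ {i j} → i < j → j < n → T i j ≡ true → i ≢ p
  true⇒≢ i<j j<n e refl = false≢true (trans (sym (after i<j j<n)) e)

-- Each clause of `MinimumSplits` makes one of the four letters the least of them. The bits that say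
-- so also show that none of the other three positions is `p`, so `others` applies to those three.
shuffled⇒tableAvoids : ∀ {p} T → Shuffled n p T → TableAvoids n Π𝒮 T
shuffled⇒tableAvoids T sh i<j j<k k<l l<n = minimumSplits⇒∉Π𝒮 _
  ( (λ ij ik il → others j<k k<l l<n (false⇒≢ i<j ij) (false⇒≢ i<k ik) (false⇒≢ i<l il))
  , (λ ij jk jl → others i<k k<l l<n (true⇒≢ i<j j<n ij) (false⇒≢ j<k jk) (false⇒≢ j<l jl))
  , (λ ik jk kl → others i<j j<l l<n (true⇒≢ i<k k<n ik) (true⇒≢ j<k k<n jk) (false⇒≢ k<l kl))
  , (λ il jl kl → others i<j j<k k<n (true⇒≢ i<l l<n il) (true⇒≢ j<l l<n jl) (true⇒≢ k<l l<n kl)))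
  where
  open Shuffled sh
  i<k = <-trans i<j j<k
  j<l = <-trans j<k k<l
  i<l = <-trans i<j j<l
  k<n = <-trans k<l l<n
  j<n = <-trans j<k k<n

-- Adjoin `p` to the triple as a fourth position. Its four possible places among i, j, k are the
-- four clauses of `MinimumSplits`.
tableAvoids⇒shuffled : ∀ {p} T → Mediated T → TableAvoids n Π𝒮 T → p < n →
  (∀ {i} → i < p → T i p ≡ true) → (∀ {j} → p < j → j < n → T p j ≡ false) → Shuffled n p T
tableAvoids⇒shuffled {n} {p} T med av p<n before after = shuffled before after others
  where
  splits : ∀ {i j k l} → i < j → j < k → k < l → l < n → MinimumSplits (table T i j k l)
  splits i<j j<k k<l l<n = ∉Π𝒮⇒minimumSplits _ (table-consistent T med i<j j<k k<l) (av i<j j<k k<l l<n)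
  others : ∀ {i j k} → i < j → j < k → k < n → i ≢ p → j ≢ p → k ≢ p → T i k ≡ T j k
  others {i} {j} {k} i<j j<k k<n i≢p j≢p k≢p with <-cmp p i | <-cmp p j | <-cmp p k
  ... | tri≈ _ e _ | _ | _ = contradiction (sym e) i≢p
  ... | _ | tri≈ _ e _ | _ = contradiction (sym e) j≢p
  ... | _ | _ | tri≈ _ e _ = contradiction (sym e) k≢p
  ... | tri< p<i _ _ | _ | _ =
    proj₁ (splits p<i i<j j<k k<n) (after p<i (<-trans i<j j<n)) (after p<j j<n) (after (<-trans p<j j<k) k<n)
    where
    j<n = <-trans j<k k<n
    p<j = <-trans p<i i<j
  ... | tri> _ _ i<p | tri< p<j _ _ | _ =
    proj₁ (proj₂ (splits i<p p<j j<k k<n)) (before i<p) (after p<j (<-trans j<k k<n)) (after (<-trans p<j j<k) k<n)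
  ... | tri> _ _ i<p | tri> _ _ j<p | tri< p<k _ _ =
    proj₁ (proj₂ (proj₂ (splits i<j j<p p<k k<n))) (before i<p) (before j<p) (after p<k k<n)
  ... | tri> _ _ i<p | tri> _ _ j<p | tri> _ _ k<p =
    proj₂ (proj₂ (proj₂ (splits i<j j<k k<p p<n))) (before i<p) (before j<p) (before k<p)

-- The table of a `Π𝒮` avoider from its descent word and a gap

shuffle : ℕ → (ℕ → Bool) → Table
shuffle p c i j = if does (i ≟ p) then false else if does (j ≟ p) then true else c j

shuffle-minˡ : ∀ p c j → shuffle p c p j ≡ false
shuffle-minˡ p c j rewrite dec-true (p ≟ p) refl = refl

shuffle-minʳ : ∀ p c {i} → i ≢ p → shuffle p c i p ≡ true
shuffle-minʳ p c {i} i≢p rewrite dec-false (i ≟ p) i≢p | dec-true (p ≟ p) refl = refl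

shuffle-other : ∀ p c {i j} → i ≢ p → j ≢ p → shuffle p c i j ≡ c j
shuffle-other p c {i} {j} i≢p j≢p rewrite dec-false (i ≟ p) i≢p | dec-false (j ≟ p) j≢p = refl

shuffle-shuffled : ∀ p c → Shuffled n p (shuffle p c)
shuffle-shuffled p c = shuffled
  (λ i<p → shuffle-minʳ p c (<⇒≢ i<p))
  (λ _ _ → shuffle-minˡ p c _)
  (λ _ _ _ i≢p j≢p k≢p → trans (shuffle-other p c i≢p k≢p) (sym (shuffle-other p c j≢p k≢p)))

-- The delicate triple has `p` in the middle: its outer bits are `true` and `false`, so either value
-- of the remaining bit matches one of them.
shuffle-mediated : ∀ p c → Mediated (shuffle p c)
shuffle-mediated p c {i} {j} {k} i<j j<k with i ≟ p | j ≟ p | k ≟ p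
... | yes refl | _        | _        = inj₁ (trans (shuffle-minˡ p c k) (sym (shuffle-minˡ p c j)))
... | no i≢p   | _        | yes refl with j ≟ p
...   | yes refl = inj₁ refl
...   | no j≢p   = inj₂ (trans (shuffle-minʳ p c i≢p) (sym (shuffle-minʳ p c j≢p)))
shuffle-mediated p c {i} {j} {k} i<j j<k | no i≢p | no j≢p   | no k≢p =
  inj₂ (trans (shuffle-other p c i≢p k≢p) (sym (shuffle-other p c j≢p k≢p)))
shuffle-mediated p c {i} {j} {k} i<j j<k | no i≢p | yes refl | no k≢p with shuffle p c i k
... | true  = inj₁ (sym (shuffle-minʳ p c i≢p))
... | false = inj₂ (sym (shuffle-minˡ p c k))

-- g ends a run of descents or starts a run of ascents of w, so the canonical
-- g correspond to the runs of w.
Canonical : (ℕ → Bool) → ℕ → Set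
Canonical w g = (w g ≡ false → g ≡ 0 ⊎ w (pred g) ≡ true)
              × (w g ≡ true → w (suc g) ≡ false)

canonical? : ∀ w → Decidable (Canonical w)
canonical? w g = (w g Bool.≟ false →-dec (g ≟ 0 ⊎-dec w (pred g) Bool.≟ true))
           ×-dec (w g Bool.≟ true →-dec w (suc g) Bool.≟ false)

-- Gap `g` lies between positions `g` and `suc g`, and the least letter takes the lower end of this
-- step.
minPosition : (ℕ → Bool) → ℕ → ℕ
minPosition w g = if w g then suc g else g

-- A constant column `j` can be read off its neighbour `pred j`, that is, from `w`. This fails only
-- just after the least letter, whose row is always `false`; that column is free, and it stores the
-- letter of the chosen gap.
column : (ℕ → Bool) → ℕ → ℕ → Bool
column w g j = if does (pred j ≟ minPosition w g) then w g else w (pred j)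

column-after : ∀ w g j → pred j ≡ minPosition w g → column w g j ≡ w g
column-after w g j e rewrite dec-true (pred j ≟ minPosition w g) e = refl

column-other : ∀ w g j → pred j ≢ minPosition w g → column w g j ≡ w (pred j)
column-other w g j e rewrite dec-false (pred j ≟ minPosition w g) e = refl

shuffleTable : (ℕ → Bool) → ℕ → Table
shuffleTable w g = shuffle (minPosition w g) (column w g)

-- The least letter forces a descent into its position and an ascent out of it. Canonicity of `g`
-- says that `w` has these letters there.
shuffleTable-descents : ∀ {w g} → Canonical w g → ∀ s → shuffleTable w g s (suc s) ≡ w s
shuffleTable-descents {w} {g} (asc , desc) s with s ≟ minPosition w g | suc s ≟ minPosition w g
... | no s≢p | no s+1≢p = trans (shuffle-other _ (column w g) s≢p s+1≢p) (column-other w g (suc s) s≢p)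
... | yes s≡p | _ = trans (cong (λ x → shuffleTable w g x (suc s)) s≡p)
                      (trans (shuffle-minˡ (minPosition w g) (column w g) (suc s)) (sym (trans (cong w s≡p) ascent)))
  where
  ascent : w (minPosition w g) ≡ false
  ascent with w g in wg
  ... | true  = desc refl
  ... | false = wg
... | no s≢p | yes s+1≡p = trans (cong (shuffleTable w g s) s+1≡p)
                      (trans (shuffle-minʳ (minPosition w g) (column w g) s≢p) (sym (trans (cong (w ∘ pred) s+1≡p) descent)))
  where
  descent : w (pred (minPosition w g)) ≡ true
  descent with w g in wg
  ... | true  = wg
  ... | false with asc refl
  ...   | inj₁ refl = contradiction s+1≡p 1+n≢0
  ...   | inj₂ x    = x

minPosition< : ∀ w {g} → suc g < n → minPosition w g < n
minPosition< w {g} g<n with w g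
... | true  = g<n
... | false = <-trans (n<1+n g) g<n

shuffleTable-minPosition-≯ : ∀ {w g g′} → suc g′ < n → Agree n (shuffleTable w g) (shuffleTable w g′) →
                             ¬ minPosition w g < minPosition w g′
shuffleTable-minPosition-≯ {w = w} {g} {g′} g′<n eq p<p′ = false≢true (begin
  false                                    ≡⟨ shuffle-minˡ p (column w g) p′ ⟨
  shuffle p (column w g) p p′              ≡⟨ eq p<p′ (minPosition< w g′<n) ⟩
  shuffle p′ (column w g′) p p′            ≡⟨ shuffle-minʳ p′ (column w g′) (<⇒≢ p<p′) ⟩
  true                                     ∎)
  where
  open ≡-Reasoning
  p  = minPosition w g
  p′ = minPosition w g′

shuffleTable-injective : ∀ {w g g′} → suc g < n → suc g′ < n →
                         Agree n (shuffleTable w g) (shuffleTable w g′) → g ≡ g′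
shuffleTable-injective {n} {w} {g} {g′} g<n g′<n eq =
  go (w g) (w g′) refl refl
  where
  same : ∀ {b b′} → w g ≡ b → w g′ ≡ b′ → (if b then suc g else g) ≡ (if b′ then suc g′ else g′)
  same refl refl = ≤-antisym
    (≮⇒≥ (shuffleTable-minPosition-≯ {w = w} {g′} {g} g<n λ x y → sym (eq x y)))
    (≮⇒≥ (shuffleTable-minPosition-≯ {w = w} {g} {g′} g′<n eq))
  -- suc h and h share the minimum position suc h; the comparison of
  -- positions h and suc (suc h) across it tells them apart.
  clash : ∀ {g h} → suc g < n → Agree n (shuffleTable w g) (shuffleTable w h) →
          w g ≡ false → w h ≡ true → g ≢ suc h
  clash {h = h} g<n eq wg wh refl = false≢true (begin
    false                                  ≡⟨ wg ⟨
    w (suc h)                              ≡⟨ column-after w (suc h) (suc (suc h)) pg ⟨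
    column w (suc h) (suc (suc h))         ≡⟨ shuffle-other _ (column w (suc h)) (λ e → <-irrefl (trans e (sym pg)) (n<1+n h))
                                                (λ e → <-irrefl (trans pg (sym e)) (n<1+n _)) ⟨
    shuffleTable w (suc h) h (suc (suc h)) ≡⟨ eq (<-trans (n<1+n h) (n<1+n _)) g<n ⟩
    shuffleTable w h h (suc (suc h))       ≡⟨ shuffle-other _ (column w h) (λ e → <-irrefl (trans e (sym ph)) (n<1+n h))
                                                (λ e → <-irrefl (trans ph (sym e)) (n<1+n _)) ⟩
    column w h (suc (suc h))               ≡⟨ column-after w h (suc (suc h)) ph ⟩
    w h                                    ≡⟨ wh ⟩
    true                                   ∎)
    where
    open ≡-Reasoning
    pg : suc h ≡ minPosition w (suc h)
    pg rewrite wg = refl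
    ph : suc h ≡ minPosition w h
    ph rewrite wh = refl
  go : ∀ b b′ → w g ≡ b → w g′ ≡ b′ → g ≡ g′
  go true  true  wg wg′ = suc-injective (same wg wg′)
  go false false wg wg′ = same wg wg′
  go false true  wg wg′ = contradiction (same wg wg′) (clash g<n eq wg wg′)
  go true  false wg wg′ = contradiction (sym (same wg wg′)) (clash g′<n (λ x y → sym (eq x y)) wg′ wg)

Descents : ℕ → (ℕ → Bool) → Table → Set
Descents N w T = ∀ s → s < N → w s ≡ T s (suc s)

-- Ascents beyond the last gap close a final run of descents, so that this run too has a canonical
-- gap.
BlankFrom : ℕ → (ℕ → Bool) → Set
BlankFrom N w = ∀ {s} → N ≤ s → w s ≡ false

-- Each gap next to `p` is canonical, as `w` descends into `p` and ascends out of it. If `p` is the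
-- first or last position there is only one such gap; otherwise the constant bit across `p` selects
-- the gap carrying the same letter.
shuffled⇒shuffleTable : ∀ {N w p T} → 0 < N → p ≤ N → Descents N w T → BlankFrom N w → Shuffled (suc N) p T →
                        ∃ λ g → g < N × Canonical w g × Agree (suc N) T (shuffleTable w g)
shuffled⇒shuffleTable {N} {w} {p} {T} 0<N p≤N des blank sh = find p refl
  where
  open Shuffled sh
  Code : Set
  Code = ∃ λ g → g < N × Canonical w g × Agree (suc N) T (shuffleTable w g)

  agree : ∀ g → minPosition w g ≡ p → (∀ {i} → i < p → suc p < suc N → T i (suc p) ≡ w g) →
          Agree (suc N) T (shuffleTable w g)
  agree g refl next {i} {j} i<j j<n with i ≟ p | j ≟ p
  ... | yes refl | _        = trans (after i<j j<n) (sym (shuffle-minˡ p (column w g) j))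
  ... | no i≢p   | yes refl = trans (before i<j) (sym (shuffle-minʳ p (column w g) i≢p))
  agree g refl next {i} {suc s} i<j j<n | no i≢p | no j≢p =
    trans (atColumn (s ≟ p)) (sym (shuffle-other p (column w g) i≢p j≢p))
    where
    atColumn : Dec (s ≡ p) → T i (suc s) ≡ column w g (suc s)
    atColumn (yes refl) = trans (next (≤∧≢⇒< (s≤s⁻¹ i<j) i≢p) j<n) (sym (column-after w g (suc s) refl))
    atColumn (no s≢p) with i ≟ s
    ... | yes refl = sym (trans (column-other w g (suc s) s≢p) (des s (s<s⁻¹ j<n)))
    ... | no i≢s   = trans (others (≤∧≢⇒< (s≤s⁻¹ i<j) i≢s) (n<1+n s) j<n i≢p s≢p j≢p)
                           (sym (trans (column-other w g (suc s) s≢p) (des s (s<s⁻¹ j<n))))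

  find : ∀ q → q ≡ p → Code
  find zero refl = 0 , 0<N , ((λ _ → inj₁ refl) , λ e → contradiction (trans (sym w0) e) false≢true) ,
                   agree 0 (cong (if_then 1 else 0) w0) λ ()
    where
    w0 : w 0 ≡ false
    w0 = trans (des 0 0<N) (after z<s (s<s 0<N))
  find (suc q) refl with p <? N
  ... | no p≮N = q , p≤N , ((λ e → contradiction (trans (sym e) wq) false≢true) , λ _ → blank (≮⇒≥ p≮N)) ,
                 agree q (cong (if_then p else q) wq) λ _ p<N → contradiction (s<s⁻¹ p<N) p≮N
    where
    wq : w q ≡ true
    wq = trans (des q p≤N) (before (n<1+n q))
  ... | yes p<N = bySide (T q (suc p)) refl
    where
    wq : w q ≡ true
    wq = trans (des q p≤N) (before (n<1+n q))
    wp : w p ≡ false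
    wp = trans (des p p<N) (after (n<1+n p) (s<s p<N))
    across : ∀ {i} → i < p → T i (suc p) ≡ T q (suc p)
    across {i} i<p with i ≟ q
    ... | yes refl = refl
    ... | no i≢q = others (≤∧≢⇒< (s≤s⁻¹ i<p) i≢q) (<-trans (n<1+n q) (n<1+n p)) (s<s p<N)
                     (<⇒≢ i<p) (<⇒≢ (n<1+n q)) (≢-sym (<⇒≢ (n<1+n p)))
    bySide : ∀ b → T q (suc p) ≡ b → Code
    bySide true  e = q , p≤N , ((λ e′ → contradiction (trans (sym e′) wq) false≢true) , λ _ → wp) ,
                     agree q (cong (if_then p else q) wq) λ i<p _ → trans (across i<p) (trans e (sym wq))
    bySide false e = p , p<N , ((λ _ → inj₂ wq) , λ e′ → contradiction (trans (sym wp) e′) false≢true) ,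
                     agree p (cong (if_then suc p else p) wp) λ i<p _ → trans (across i<p) (trans e (sym wp))

-- Arc permutations

clamp : ℕ → ℕ → ℕ → ℕ
clamp g i j = i ⊔ (g ⊓ pred j)

clamp-low : ∀ {g i j} → g ≤ pred j → clamp g i j ≡ i ⊔ g
clamp-low {i = i} g≤j = cong (i ⊔_) (m≤n⇒m⊓n≡m g≤j)

clamp-mid : ∀ {g i j} → i ≤ g → g ≤ pred j → clamp g i j ≡ g
clamp-mid {i = i} {j} i≤g g≤j = trans (clamp-low {i = i} {j} g≤j) (m≤n⇒m⊔n≡n i≤g)

clamp-left : ∀ {g i} j → g ≤ i → clamp g i j ≡ i
clamp-left {g} j g≤i = m≥n⇒m⊔n≡m (≤-trans (m⊓n≤m g (pred j)) g≤i)

clamp-right : ∀ {g i j} → i ≤ pred j → pred j ≤ g → clamp g i j ≡ pred j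
clamp-right {i = i} i≤j j≤g = trans (cong (i ⊔_) (m≥n⇒m⊓n≡n j≤g)) (m≤n⇒m⊔n≡n i≤j)

clamp-high : ∀ {g i j k} → i < j → j ≤ g → j < k → clamp g i k ≡ clamp g j k
clamp-high i<j j≤g j<k =
  trans (m≤n⇒m⊔n≡n (≤-trans (<⇒≤ i<j) j≤)) (sym (m≤n⇒m⊔n≡n j≤))
  where j≤ = ⊓-glb j≤g (<⇒≤pred j<k)

-- The letters up to position `g` lie all below or all above the later ones; each of them is extreme
-- among those before it, and each later letter is extreme among those after it.
arcTable : (ℕ → Bool) → ℕ → Table
arcTable w g i j = w (clamp g i j)

-- If `j` is at most `g`, rows `i` and `j` agree beyond `j`; if `j` exceeds `g`, columns `j` and `k`
-- agree. The same dichotomy gives avoidance of `Π𝒜` below.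
arcTable-mediated : ∀ w g → Mediated (arcTable w g)
arcTable-mediated w g {i} {j} {k} i<j@(s≤s _) j<k with j ≤? g
... | yes j≤g = inj₂ (cong w (clamp-high i<j j≤g j<k))
... | no  j≰g = inj₁ (cong w (trans (clamp-low {i = i} {k} (≤-trans g≤j (pred-mono-≤ (<⇒≤ j<k))))
                                    (sym (clamp-low {i = i} {j} g≤j))))
  where g≤j = s≤s⁻¹ (≰⇒> j≰g)

arcTable-tableAvoids : ∀ w g → TableAvoids n Π𝒜 (arcTable w g)
arcTable-tableAvoids w g {i} {j} {k} {l} i<j@(s≤s _) j<k k<l _ = parallel⇒∉Π𝒜 _ parallel
  where
  j<l = <-trans j<k k<l
  parallel : Parallel (table (arcTable w g) i j k l)
  parallel with j ≤? g
  ... | yes j≤g rewrite clamp-high i<j j≤g j<k | clamp-high i<j j≤g j<l =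
    trans (Bool.xor-same (arcTable w g j k)) (sym (Bool.xor-same (arcTable w g j l)))
  ... | no  j≰g = cong₂ _xor_ (cong w (low i)) (cong w (low j))
    where
    g≤j = s≤s⁻¹ (≰⇒> j≰g)
    low : ∀ x → clamp g x k ≡ clamp g x l
    low x = trans (clamp-low {i = x} {k} (≤-trans g≤j (pred-mono-≤ (<⇒≤ j<k))))
                  (sym (clamp-low {i = x} {l} (≤-trans g≤j (pred-mono-≤ (<⇒≤ j<l)))))

arcTable-descents : ∀ w g s → arcTable w g s (suc s) ≡ w s
arcTable-descents w g s = cong w (m≥n⇒m⊔n≡m (m⊓n≤n g s))

-- The entry at positions `g` and `suc h` is clamped to `h` by `g′` and to `g` by `g`. Hence gaps
-- with equal tables lie in one run.
arcTable-constant : ∀ {w g g′} → g′ < n → Agree (suc n) (arcTable w g) (arcTable w g′) →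
                    ∀ {h} → g ≤ h → h ≤ g′ → w h ≡ w g
arcTable-constant {w = w} {g} {g′} g′<n eq {h} g≤h h≤g′ = begin
  w h                        ≡⟨ cong w (clamp-right {g′} {g} {suc h} g≤h h≤g′) ⟨
  arcTable w g′ g (suc h)    ≡⟨ eq (s≤s g≤h) (s≤s (≤-<-trans h≤g′ g′<n)) ⟨
  arcTable w g g (suc h)     ≡⟨ cong w (clamp-mid {g} {g} {suc h} ≤-refl g≤h) ⟩
  w g                        ∎
  where open ≡-Reasoning

arcTable-≯ : ∀ {w g g′} → g′ < n → Canonical w g → Canonical w g′ →
             Agree (suc n) (arcTable w g) (arcTable w g′) → ¬ g < g′
arcTable-≯ {w = w} {g} {suc h} g′<n (_ , desc) (asc , _) eq g<g′ = go (w g) refl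
  where
  constant : ∀ {x} → g ≤ x → x ≤ suc h → w x ≡ w g
  constant = arcTable-constant g′<n eq
  go : ∀ b → ¬ w g ≡ b
  go true  e = false≢true (trans (sym (desc e)) (trans (constant (n≤1+n g) g<g′) e))
  go false e with asc (trans (constant (<⇒≤ g<g′) ≤-refl) e)
  ... | inj₂ wh = false≢true (trans (sym e) (trans (sym (constant (s≤s⁻¹ g<g′) (n≤1+n h))) wh))

arcTable-injective : ∀ {w g g′} → g < n → g′ < n → Canonical w g → Canonical w g′ →
                     Agree (suc n) (arcTable w g) (arcTable w g′) → g ≡ g′
arcTable-injective g<n g′<n c c′ eq = ≤-antisym
  (≮⇒≥ (arcTable-≯ g<n c′ c λ x y → sym (eq x y)))
  (≮⇒≥ (arcTable-≯ g′<n c c′ eq))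

arcTable-shift : ∀ {w g} → w g ≡ w (suc g) → ∀ i j → arcTable w g i j ≡ arcTable w (suc g) i j
arcTable-shift {w} {g} eq i j with pred j ≤? g
... | yes j≤g = cong (λ x → w (i ⊔ x)) (trans (m≥n⇒m⊓n≡n j≤g) (sym (m≥n⇒m⊓n≡n (m≤n⇒m≤1+n j≤g))))
... | no  j≰g with i ≤? g
...   | yes i≤g = trans (cong w (clamp-mid {g} {i} {j} i≤g (<⇒≤ (≰⇒> j≰g))))
                    (trans eq (cong w (sym (clamp-mid {suc g} {i} {j} (m≤n⇒m≤1+n i≤g) (≰⇒> j≰g)))))
...   | no  i≰g = cong w (trans (clamp-left j (<⇒≤ (≰⇒> i≰g))) (sym (clamp-left j (≰⇒> i≰g))))

-- The gap slides along its run without changing the table, down to the start of a run of ascents or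
-- up to the end of a run of descents. The latter stops before `N`, where `w` is blank.
arcTable-canonical : ∀ {N w g} → BlankFrom N w → g < N →
  ∃ λ h → h < N × Canonical w h × (∀ i j → arcTable w g i j ≡ arcTable w h i j)
arcTable-canonical {N} {w} {g} blank g<N = byLetter (w g) refl
  where
  Result : ℕ → Set
  Result g = ∃ λ h → h < N × Canonical w h × (∀ i j → arcTable w g i j ≡ arcTable w h i j)

  down : ∀ g → g < N → w g ≡ false → Result g
  down zero    g<N e = 0 , g<N , ((λ _ → inj₁ refl) , λ e′ → contradiction (trans (sym e) e′) false≢true) , λ _ _ → refl
  down (suc g) g<N e = prev (w g) refl
    where
    prev : ∀ b → w g ≡ b → Result (suc g)
    prev true  e′ = suc g , g<N , ((λ _ → inj₂ e′) , λ e″ → contradiction (trans (sym e) e″) false≢true) , λ _ _ → refl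
    prev false e′ with h , h<N , c , eq ← down g (<-trans (n<1+n g) g<N) e′
      = h , h<N , c , λ i j → trans (sym (arcTable-shift {w} {g} (trans e′ (sym e)) i j)) (eq i j)

  up : ∀ d g → g + d ≡ N → w g ≡ true → Result g
  up zero    g eqN e = contradiction (trans (sym (blank (≤-reflexive (trans (sym eqN) (+-identityʳ g))))) e) false≢true
  up (suc d) g eqN e = next (w (suc g)) refl
    where
    next : ∀ b → w (suc g) ≡ b → Result g
    next false e′ = g , subst (g <_) eqN (m<m+n g z<s) ,
                    ((λ e″ → contradiction (trans (sym e″) e) false≢true) , λ _ → e′) , λ _ _ → refl
    next true  e′ with h , h<N , c , eq ← up d (suc g) (trans (sym (+-suc g d)) eqN) e′
      = h , h<N , c , λ i j → trans (arcTable-shift {w} {g} (trans e (sym e′)) i j) (eq i j)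

  byLetter : ∀ b → w g ≡ b → Result g
  byLetter false e = down g g<N e
  byLetter true  e = up (N ∸ g) g (m+[n∸m]≡n (<⇒≤ g<N)) e

xor-cancelˡ : ∀ e {x y} → e xor x ≡ e xor y → x ≡ y
xor-cancelˡ false eq = eq
xor-cancelˡ true  eq = Bool.not-injective eq

xor-equal : ∀ {x y z} → x xor y ≡ z xor z → x ≡ y
xor-equal {x} {y} {z} eq = sym (xor-cancelˡ x (trans eq (trans (Bool.xor-same z) (sym (Bool.xor-same x)))))

-- Position suc g is the first at which the values seen so far include both the
-- least and the greatest; s is the position of the one seen earlier.
parallel⇒arcTable : ∀ {N w g s e T} → TableAvoids (suc N) Π𝒜 T → Mediated T → Descents N w T → g < N → s ≤ g →
  (∀ {x} → x ≤ g → T x (suc g) ≡ e) → (∀ {j} → s < j → j < suc N → T s j ≡ e) →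
  Agree (suc N) T (arcTable w g)
parallel⇒arcTable {N} {w} {g} {s} {e} {T} av med des g<N s≤g toG fromS {i} {suc j} i<j+1 j+1<n = go
  where
  open ≡-Reasoning
  i≤j = s≤s⁻¹ i<j+1
  j<N = s<s⁻¹ j+1<n
  parallel : ∀ {i j k l} → i < j → j < k → k < l → l < suc N → T i k xor T j k ≡ T i l xor T j l
  parallel i<j j<k k<l l<n = ∉Π𝒜⇒parallel _ (table-consistent T med i<j j<k k<l) (av i<j j<k k<l l<n)

  -- Rows `i` and `s` agree in column `suc g`, so they agree in column `suc j`, where row `s` is
  -- known.
  sameAfter : g < j → i ≤ g → T i (suc j) ≡ e
  sameAfter g<j i≤g with <-cmp i s
  ... | tri≈ _ refl _ = fromS i<j+1 j+1<n
  ... | tri< i<s _ _  = trans (xor-equal {z = e} (begin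
      T i (suc j) xor T s (suc j)   ≡⟨ parallel i<s (s≤s s≤g) (s≤s g<j) j+1<n ⟨
      T i (suc g) xor T s (suc g)   ≡⟨ cong₂ _xor_ (toG i≤g) (toG s≤g) ⟩
      e xor e                       ∎)) (fromS (≤-<-trans s≤g (m≤n⇒m≤1+n g<j)) j+1<n)
  ... | tri> _ _ s<i  = trans (sym (xor-equal {z = e} (begin
      T s (suc j) xor T i (suc j)   ≡⟨ parallel s<i (s≤s i≤g) (s≤s g<j) j+1<n ⟨
      T s (suc g) xor T i (suc g)   ≡⟨ cong₂ _xor_ (toG s≤g) (toG i≤g) ⟩
      e xor e                       ∎))) (fromS (≤-<-trans s≤g (m≤n⇒m≤1+n g<j)) j+1<n)

  go : T i (suc j) ≡ arcTable w g i (suc j)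
  go with <-cmp j g | i ≤? g
  ... | tri< j<g _ _ | _ = trans same (trans (sym (des j j<N)) (cong w (sym (clamp-right {g} {i} {suc j} i≤j (<⇒≤ j<g)))))
    where
    -- Column `suc g` is constant up to `g`, and `parallel` carries this back to the earlier column.
    same : T i (suc j) ≡ T j (suc j)
    same with i ≟ j
    ... | yes refl = refl
    ... | no i≢j   = xor-equal {z = e} (begin
      T i (suc j) xor T j (suc j)   ≡⟨ parallel (≤∧≢⇒< i≤j i≢j) (n<1+n j) (s≤s j<g) (s≤s g<N) ⟩
      T i (suc g) xor T j (suc g)   ≡⟨ cong₂ _xor_ (toG (≤-trans i≤j (<⇒≤ j<g))) (toG (<⇒≤ j<g)) ⟩
      e xor e                       ∎)
  ... | tri≈ _ refl _ | _ = begin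
      T i (suc g)            ≡⟨ trans (toG i≤j) (sym (toG ≤-refl)) ⟩
      T g (suc g)            ≡⟨ des g g<N ⟨
      w g                    ≡⟨ cong w (clamp-mid {g} {i} {suc g} i≤j ≤-refl) ⟨
      arcTable w g i (suc g) ∎
  ... | tri> _ _ g<j | yes i≤g = begin
      T i (suc j)            ≡⟨ trans (sameAfter g<j i≤g) (sym (toG ≤-refl)) ⟩
      T g (suc g)            ≡⟨ des g g<N ⟨
      w g                    ≡⟨ cong w (clamp-mid {g} {i} {suc j} i≤g (<⇒≤ g<j)) ⟨
      arcTable w g i (suc j) ∎
  ... | tri> _ _ g<j | no i≰g = trans same (trans (sym (des i (≤-<-trans i≤j j<N))) (cong w (sym (clamp-left (suc j) (<⇒≤ (≰⇒> i≰g))))))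
    where
    s<i = ≤-<-trans s≤g (≰⇒> i≰g)
    -- Row `s` is constant after `s`, so cancelling it from `parallel` leaves row `i` constant.
    same : T i (suc j) ≡ T i (suc i)
    same with i ≟ j
    ... | yes refl = refl
    ... | no i≢j   = sym (xor-cancelˡ e (begin
      e xor T i (suc i)             ≡⟨ cong (_xor _) (fromS (m≤n⇒m≤1+n s<i) i+1<n) ⟨
      T s (suc i) xor T i (suc i)   ≡⟨ parallel s<i (n<1+n i) (s≤s (≤∧≢⇒< i≤j i≢j)) j+1<n ⟩
      T s (suc j) xor T i (suc j)   ≡⟨ cong (_xor _) (fromS (<-trans s<i i<j+1) j+1<n) ⟩
      e xor T i (suc j)             ∎))
      where i+1<n = ≤-<-trans i<j+1 j+1<n

-- Enumeration of the avoiders by descent set and run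

record Encoding (N : ℕ) (Π : List (OneLine 4)) : Set where
  field
    perms     : All IsPerm Π
    tab       : (ℕ → Bool) → ℕ → Table
    mediated  : ∀ w g → Mediated (tab w g)
    descents  : ∀ {w g} → Canonical w g → ∀ s → tab w g s (suc s) ≡ w s
    injective : ∀ {w g g′} → g < N → g′ < N → Canonical w g → Canonical w g′ →
                Agree (suc N) (tab w g) (tab w g′) → g ≡ g′
    sound     : ∀ w g → TableAvoids (suc N) Π (tab w g)
    complete  : ∀ {w} {σ : OneLine (suc N)} → IsPerm σ → TableAvoids (suc N) Π (inv σ) →
                Descents N w (inv σ) → BlankFrom N w →
                ∃ λ g → g < N × Canonical w g × Agree (suc N) (inv σ) (tab w g)

encoding𝒮 : ∀ N → 0 < N → Encoding N Π𝒮
encoding𝒮 N 0<N = record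
  { perms     = Π𝒮-perm
  ; tab       = shuffleTable
  ; mediated  = λ w g → shuffle-mediated (minPosition w g) (column w g)
  ; descents  = shuffleTable-descents
  ; injective = λ {w} {g} {g′} g<N g′<N _ _ → shuffleTable-injective {w = w} {g} {g′} (s<s g<N) (s<s g′<N)
  ; sound     = λ w g → shuffled⇒tableAvoids (shuffleTable w g) (shuffle-shuffled (minPosition w g) (column w g))
  ; complete  = complete
  }
  where
  complete : ∀ {w} {σ : OneLine (suc N)} → IsPerm σ → TableAvoids (suc N) Π𝒮 (inv σ) →
             Descents N w (inv σ) → BlankFrom N w →
             ∃ λ g → g < N × Canonical w g × Agree (suc N) (inv σ) (shuffleTable w g)
  complete {w} {σ} u av des blank with p , p<n , e ← val-surjective u z<s =
    shuffled⇒shuffleTable {w = w} {p} {inv σ} 0<N (s≤s⁻¹ p<n) des blank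
      (tableAvoids⇒shuffled (inv σ) (inv-mediated σ) av p<n
        (λ {i} i<p → inv-true σ (subst (_< val σ i) (sym e) (n≢0⇒n>0 λ e′ →
          <⇒≢ i<p (val-injective u (<-trans i<p p<n) p<n (trans e′ (sym e))))))
        (λ {j} _ _ → inv-false σ (subst (_≤ val σ j) (sym e) z≤n)))

encoding𝒜 : ∀ N → 0 < N → Encoding N Π𝒜
encoding𝒜 N 0<N = record
  { perms     = Π𝒜-perm
  ; tab       = arcTable
  ; mediated  = arcTable-mediated
  ; descents  = λ {w} {g} _ → arcTable-descents w g
  ; injective = arcTable-injective
  ; sound     = arcTable-tableAvoids
  ; complete  = complete
  }
  where
  complete : ∀ {w} {σ : OneLine (suc N)} → IsPerm σ → TableAvoids (suc N) Π𝒜 (inv σ) →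
             Descents N w (inv σ) → BlankFrom N w →
             ∃ λ g → g < N × Canonical w g × Agree (suc N) (inv σ) (arcTable w g)
  complete {w} {σ} u av des blank
    with p , p<n , ep ← val-surjective u z<s
       | q , q<n , eq ← val-surjective u (n<1+n N)
    = extremes (<-cmp p q)
    where
    least : ∀ {i} → val σ p ≤ val σ i
    least = subst (_≤ _) (sym ep) z≤n

    greatest : ∀ {i} → i < suc N → val σ i ≤ val σ q
    greatest i<n = subst (_ ≤_) (sym eq) (s≤s⁻¹ (val<n σ i<n))

    Result : Set
    Result = ∃ λ g → g < N × Canonical w g × Agree (suc N) (inv σ) (arcTable w g)

    result : ∀ {g s e} → g < N → s ≤ g → (∀ {x} → x ≤ g → inv σ x (suc g) ≡ e) →
             (∀ {j} → s < j → j < suc N → inv σ s j ≡ e) → Result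
    result {g} {s} {e} g<N s≤g toG fromS with h , h<N , c , same ← arcTable-canonical {w = w} blank g<N =
      h , h<N , c , λ {i} {j} i<j j<n →
        trans (parallel⇒arcTable {w = w} {g} {s} {e} {inv σ} av (inv-mediated σ) des g<N s≤g toG fromS i<j j<n) (same i j)

    -- The earlier of the two extreme letters stands at `s`, the later at `suc g`. Least first makes
    -- `e` the bit `false`; greatest first makes it `true`.
    extremes : Tri (p < q) (p ≡ q) (q < p) → Result
    extremes (tri≈ _ refl _) = contradiction (trans (sym ep) eq) (<⇒≢ 0<N)
    extremes (tri< (s≤s p≤g) _ _) = result (s≤s⁻¹ q<n) p≤g
      (λ x≤g → inv-false σ (greatest (≤-<-trans x≤g (<-trans (n<1+n _) q<n))))
      (λ _ _ → inv-false σ least)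
    extremes (tri> _ _ (s≤s q≤g)) = result (s≤s⁻¹ p<n) q≤g
      (λ x≤g → inv-true σ (≤∧≢⇒< least λ e →
        <⇒≢ (s≤s x≤g) (val-injective u (≤-<-trans x≤g (<-trans (n<1+n _) p<n)) p<n (sym e))))
      (λ q<j j<n → inv-true σ (≤∧≢⇒< (greatest j<n) λ e → <⇒≢ q<j (val-injective u q<n j<n (sym e))))

subsets : ∀ n → List (Subset n)
subsets zero    = [] ∷ []
subsets (suc n) = cartesianProductWith _∷_ (false ∷ true ∷ []) (subsets n)

∈-subsets : (b : Subset n) → b List∈.∈ subsets n
∈-subsets []      = here refl
∈-subsets (x ∷ b) = ∈-cartesianProductWith⁺ _∷_ (∈-bools x) (∈-subsets b)
  where
  ∈-bools : ∀ x → x List∈.∈ (false ∷ true ∷ [])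
  ∈-bools false = here refl
  ∈-bools true  = there (here refl)

subsets-unique : ∀ n → UniqueList (subsets n)
subsets-unique zero    = [] ∷ []
subsets-unique (suc n) =
  UniqueList.cartesianProductWith⁺ _∷_ ∷-injective ((false≢true ∷ []) ∷ [] ∷ []) (subsets-unique n)

-- Injectivity is asked only on the list because an `Encoding` separates only canonical gaps.
map-unique : ∀ {A B : Set} (f : A → B) {xs : List A} →
             (∀ {x y} → x List∈.∈ xs → y List∈.∈ xs → f x ≡ f y → x ≡ y) →
             UniqueList xs → UniqueList (List.map f xs)
map-unique f inj []        = []
map-unique f inj (x∉ ∷ u) =
  All.map⁺ (All.tabulate λ y∈ e → All.lookup x∉ y∈ (inj (here refl) (there y∈) e)) ∷
  map-unique f (λ p q → inj (there p) (there q)) u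

letters : Subset n → ℕ → Bool
letters = nth false

-- One list for both classes, since it depends on `N` alone.
codes : ∀ N → List (Subset N × Fin N)
codes N = filter (λ (w , g) → canonical? (letters w) (toℕ g)) (cartesianProduct (subsets N) (allFin N))

codes-unique : ∀ N → UniqueList (codes N)
codes-unique N = UniqueList.filter⁺ _ (UniqueList.cartesianProduct⁺ (subsets-unique N) (UniqueList.allFin⁺ N))

∈-codes⁺ : ∀ {N w g} → Canonical (letters w) (toℕ g) → (w , g) List∈.∈ codes N
∈-codes⁺ {w = w} {g} = ∈-filter⁺ _ (∈-cartesianProduct⁺ (∈-subsets w) (∈-allFin g))

∈-codes⁻ : ∀ {N w g} → (w , g) List∈.∈ codes N → Canonical (letters w) (toℕ g)
∈-codes⁻ {N} = proj₂ ∘ ∈-filter⁻ _ {xs = cartesianProduct (subsets N) (allFin N)}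

letters-Des : ∀ {N} (σ : OneLine (suc N)) → Descents N (letters (Des σ)) (inv σ)
letters-Des σ s s<N = begin
  nth false (Des σ) s                                       ≡⟨ nth-< false (Des σ) s<N ⟩
  lookup (Des σ) a                                          ≡⟨ lookup∘tabulate _ a ⟩
  does (lookup σ (suc a) Finₚ.<? lookup σ (Fin.inject₁ a))  ≡⟨ inv-lookup σ (Fin.inject₁ a) (suc a) ⟨
  inv σ (toℕ (Fin.inject₁ a)) (suc (toℕ a))                 ≡⟨ cong₂ (inv σ) (trans (toℕ-inject₁ a) (toℕ-fromℕ< s<N))
                                                                             (cong suc (toℕ-fromℕ< s<N)) ⟩
  inv σ s (suc s)                                           ∎
  where
  open ≡-Reasoning
  a = fromℕ< s<N

∈-𝔖⁺ : ∀ {Π : List (OneLine 4)} {σ : OneLine n} → IsPerm σ → Avoids Π σ → σ List∈.∈ 𝔖 n Π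
∈-𝔖⁺ {Π = Π} {σ} u av = ∈-filter⁺ (λ σ → isPerm? σ ×-dec avoids? Π σ) (∈-words σ) (u , av)

∈-𝔖⁻ : ∀ {Π : List (OneLine 4)} {σ : OneLine n} → σ List∈.∈ 𝔖 n Π → IsPerm σ × Avoids Π σ
∈-𝔖⁻ {n} {Π} = proj₂ ∘ ∈-filter⁻ (λ σ → isPerm? σ ×-dec avoids? Π σ) {xs = words n n}

𝔖-unique : ∀ n (Π : List (OneLine 4)) → UniqueList (𝔖 n Π)
𝔖-unique n Π = UniqueList.filter⁺ (λ σ → isPerm? σ ×-dec avoids? Π σ) (words-unique n n)

module _ {N : ℕ} {Π : List (OneLine 4)} (encoding : Encoding N Π) where

  open Encoding encoding

  tabOf : Subset N × Fin N → Table
  tabOf (w , g) = tab (letters w) (toℕ g)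

  decode : Subset N × Fin N → OneLine (suc N)
  decode (w , g) = realise _ (mediated (letters w) (toℕ g)) (suc N)

  decode-perm : ∀ c → IsPerm (decode c)
  decode-perm (w , g) = realise-perm _ (mediated (letters w) (toℕ g)) (suc N)

  decode-inv : ∀ c → Agree (suc N) (inv (decode c)) (tabOf c)
  decode-inv (w , g) = realise-inv _ (mediated (letters w) (toℕ g)) (suc N)

  Des-decode : ∀ {c} → c List∈.∈ codes N → Des (decode c) ≡ proj₁ c
  Des-decode {c@(w , g)} c∈ = nth-ext false _ w λ s s<N → begin
    letters (Des (decode c)) s  ≡⟨ letters-Des (decode c) s s<N ⟩
    inv (decode c) s (suc s)    ≡⟨ decode-inv c (n<1+n s) (s<s s<N) ⟩
    tabOf c s (suc s)           ≡⟨ descents (∈-codes⁻ c∈) s ⟩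
    letters w s                 ∎
    where open ≡-Reasoning

  decode-injective : ∀ {c c′} → c List∈.∈ codes N → c′ List∈.∈ codes N → decode c ≡ decode c′ → c ≡ c′
  decode-injective {c@(w , g)} {c′@(w′ , g′)} c∈ c′∈ e
    -- Equal permutations have equal descent words, so only the gaps remain to be compared.
    with refl ← trans (sym (Des-decode c∈)) (trans (cong Des e) (Des-decode c′∈))
    = cong (w ,_) (toℕ-injective (injective (toℕ<n g) (toℕ<n g′) (∈-codes⁻ c∈) (∈-codes⁻ c′∈) λ {i} {j} i<j j<n →
        trans (sym (decode-inv c i<j j<n)) (trans (cong (λ σ → inv σ i j) e) (decode-inv c′ i<j j<n))))

  decode-∈ : ∀ c → decode c List∈.∈ 𝔖 (suc N) Π
  decode-∈ c@(w , g) = ∈-𝔖⁺ {σ = decode c} (decode-perm c)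
    (tableAvoids⇒avoids {σ = decode c} λ i<j j<k k<l l<n →
      subst (List∈._∉ tables Π) (sym (table-cong {T = inv (decode c)} {tabOf c} (decode-inv c) i<j j<k k<l l<n))
        (sound (letters w) (toℕ g) i<j j<k k<l l<n))

  decode-complete : ∀ {σ} → IsPerm σ → Avoids Π σ → ∃ λ c → c List∈.∈ codes N × σ ≡ decode c
  decode-complete {σ} u av = fromCode (complete {letters (Des σ)} {σ} u
    (avoids⇒tableAvoids {σ = σ} perms u av) (letters-Des σ) (nth-beyond false (Des σ)))
    where
    fromCode : (∃ λ g → g < N × Canonical (letters (Des σ)) g × Agree (suc N) (inv σ) (tab (letters (Des σ)) g)) →
               ∃ λ c → c List∈.∈ codes N × σ ≡ decode c
    fromCode (g , g<N , c , agree) = code , ∈-codes⁺ (subst (Canonical (letters (Des σ))) (sym g≡) c) ,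
      inv-injective {σ = σ} {decode code} u (decode-perm code) λ {i} {j} i<j j<n →
        trans (agree i<j j<n) (trans (cong (λ g → tab (letters (Des σ)) g i j) (sym g≡))
                                     (sym (decode-inv code i<j j<n)))
      where
      code = Des σ , fromℕ< g<N
      g≡ = toℕ-fromℕ< g<N

  -- Two lists without repetitions and with the same members are rearrangements of each other.
  codes↭𝔖 : List.map decode (codes N) ↭ 𝔖 (suc N) Π
  codes↭𝔖 = ∼bag⇒↭ (unique∧set⇒bag
    (map-unique decode decode-injective (codes-unique N))
    (𝔖-unique (suc N) Π)
    (mk⇔ (λ σ∈ → case ∈-map⁻ decode σ∈ of λ (c , _ , e) → subst (List∈._∈ 𝔖 (suc N) Π) (sym e) (decode-∈ c))
         (λ σ∈ → case uncurry decode-complete (∈-𝔖⁻ σ∈) of λ (c , c∈ , e) →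
           subst (List∈._∈ List.map decode (codes N)) (sym e) (∈-map⁺ decode c∈))))

  -- The right-hand side mentions neither `Π` nor its encoding, so any two encoded classes have the
  -- same series.
  Q-codes : ∀ {k} (a : Vec ℕ k) → Q (suc N) Π a ≡ sum (List.map (λ c → F (suc N) (proj₁ c) a) (codes N))
  Q-codes a = begin
    sum (List.map weight (𝔖 (suc N) Π))                      ≡⟨ sum-↭ (↭.map⁺ weight codes↭𝔖) ⟨
    sum (List.map weight (List.map decode (codes N)))        ≡⟨ cong sum (map-∘ (codes N)) ⟨
    sum (List.map (weight ∘ decode) (codes N))               ≡⟨ cong sum (map-cong-local
      (All.tabulate λ c∈ → cong (λ D → F (suc N) D a) (Des-decode c∈))) ⟩
    sum (List.map (λ c → F (suc N) (proj₁ c) a) (codes N))   ∎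
    where
    open ≡-Reasoning
    weight : OneLine (suc N) → ℕ
    weight σ = F (suc N) (Des σ) a

proposition6p2 : (n : ℕ) → Q n Π𝒮 ≈ Q n Π𝒜
proposition6p2 zero          a = refl
-- One letter leaves no gap for a code; both sums are small enough to agree by computation.
proposition6p2 (suc zero)    a = refl
proposition6p2 (suc (suc m)) a =
  trans (Q-codes (encoding𝒮 (suc m) z<s) a) (sym (Q-codes (encoding𝒜 (suc m) z<s) a))
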